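{- The following is provable in $\mathbf{ZF}$ (Zermelo-Fraenkel set theory without the axiom of choice): if $T$ is an $\mathbb{R}$-tree, $S$ is a metric space, and $f:T\to S$ is a quasi-isometry, then there exists a quasi-isometry $h:S\to T$.
   Context: Quasi-isometry: for metric spaces $(S,d_S)$ and $(T,d_T)$, a function $f:S\to T$ is a quasi-isometry if there exists a natural number $N\ge 1$ such that $B(f(S),N)=T$ and for all $x,y\in S$, $\frac1N d_S(x,y)-N\le d_T(f(x),f(y))\le N d_S(x,y)+N$. Here, for $J\subseteq T$, $B(J,p)=\{x\in T: d_T(x,J)\le p\}$ is the closed $p$-neighborhood (with $d_T(x,\emptyset)=+\infty$). A metric space $S$ is geodesic if for any $x,y\in S$ there is an isometric embedding $\rho:[0,d_S(x,y)]\to S$ with $\rho(0)=x$, $\rho(d_S(x,y))=y$; its image is called a geodesic segment, denoted $[x,y]$. A geodesic space $S$ is $\delta$-hyperbolic if for any $x,y,z\in S$ (and any choice of geodesic segments) $[x,y]\subseteq B([x,z]\cup[y,z],\delta)$. An $\mathbb{R}$-tree is a $0$-hyperbolic geodesic space (geodesic segments are then unique). -}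

module Defs where

open import Level using (Level; _⊔_) renaming (suc to lsuc)
open import Algebra.Core using (Op₁; Op₂)
open import Algebra.Structures using (IsCommutativeRing)
open import Data.Nat.Base using (ℕ; zero; suc) renaming (_≤_ to _≤ℕ_)
open import Data.Product.Base using (Σ; _×_; _,_; proj₁)
open import Data.Sum.Base using ([_,_]′)
open import Function.Base using (const)
open import Relation.Binary.Core using (Rel)
open import Relation.Binary.Structures using (IsTotalOrder)
open import Relation.Binary.PropositionalEquality.Core using (_≡_; _≢_; refl)
open import Relation.Nullary using (¬_; Dec; Irrelevant)
open import Relation.Unary using (Pred; _∈_; _⊆_; _∪_)

private
  variable
    a p ℓ : Level

-- "Provable in ZF" is rendered as provability in a classical, choice-free
-- setting: Agda, with function extensionality and excluded middle as
-- hypotheses.  Excluded middle is restricted to propositions (types with at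
-- most one element).  The unrestricted `Axiom.ExcludedMiddle` would turn
-- ¬ ¬ A into A for every type A, which is global choice.

PropExcludedMiddle : (ℓ : Level) → Set (lsuc ℓ)
PropExcludedMiddle ℓ = {P : Set ℓ} → Irrelevant P → Dec P

-- Mere existence.  Σ would not do: a proof of ∀ x → Σ B (R x) is already a
-- choice function.  Given extensionality and PropExcludedMiddle, ¬ ¬ is the
-- propositional truncation, so a witness can be extracted only when it is
-- unique.

∃ᶜ : {A : Set a} → (A → Set p) → Set (a ⊔ p)
∃ᶜ {A = A} P = ¬ ¬ Σ A P

infix 2 ∃ᶜ
syntax ∃ᶜ (λ x → P) = ∃ᶜ[ x ] P

module _ {A : Set ℓ} (_≤_ : Rel A ℓ) where

  IsUpperBound IsLowerBound IsSup IsInf : Pred A ℓ → Pred A ℓ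
  IsUpperBound P u = ∀ x → x ∈ P → x ≤ u
  IsLowerBound P l = ∀ x → x ∈ P → l ≤ x
  IsSup P s = IsUpperBound P s × (∀ u → IsUpperBound P u → s ≤ u)
  IsInf P i = IsLowerBound P i × (∀ l → IsLowerBound P l → l ≤ i)

-- The real numbers, characterised up to isomorphism as a Dedekind-complete
-- ordered field.  The inverse is made total by the convention 0⁻¹ = 0.

record CompleteOrderedField (ℓ : Level) : Set (lsuc ℓ) where
  infix  8 _⁻¹
  infix  8 -_
  infixl 7 _*_
  infixl 6 _+_ _-_
  infix  4 _≤_

  field
    Carrier           : Set ℓ
    _+_ _*_           : Op₂ Carrier
    -_ _⁻¹            : Op₁ Carrier
    0# 1#             : Carrier
    _≤_               : Rel Carrier ℓ
    isCommutativeRing : IsCommutativeRing _≡_ _+_ _*_ -_ 0# 1#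
    0≢1               : 0# ≢ 1#
    *-inverseʳ        : ∀ x → x ≢ 0# → x * x ⁻¹ ≡ 1#
    0⁻¹≡0             : 0# ⁻¹ ≡ 0#
    isTotalOrder      : IsTotalOrder _≡_ _≤_
    ≤-irrelevant      : ∀ {x y} → Irrelevant (x ≤ y)
    +-monoˡ-≤         : ∀ z {x y} → x ≤ y → x + z ≤ y + z
    *-nonNegative     : ∀ {x y} → 0# ≤ x → 0# ≤ y → 0# ≤ x * y
    complete          : (A : Pred Carrier ℓ) →
                        (∃ᶜ[ x ] x ∈ A) → (∃ᶜ[ u ] IsUpperBound _≤_ A u) →
                        (∃ᶜ[ s ] IsSup _≤_ A s)

  open IsTotalOrder isTotalOrder public
    using (total) renaming (refl to ≤-refl)

  _-_ : Op₂ Carrier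
  x - y = x + (- y)

  ∣_∣ : Op₁ Carrier
  ∣ x ∣ = [ const x , const (- x) ]′ (total 0# x)

  fromℕ : ℕ → Carrier
  fromℕ zero    = 0#
  fromℕ (suc n) = 1# + fromℕ n

image : {A B : Set ℓ} → (A → B) → Pred B ℓ
image f y = ∃ᶜ[ x ] f x ≡ y

module _ (ℝ : CompleteOrderedField ℓ) where
  open CompleteOrderedField ℝ renaming (Carrier to R)

  -- Points are compared by _≡_ rather than by a setoid equality: as in set
  -- theory, a point that is uniquely determined can then be named.

  record MetricSpace : Set (lsuc ℓ) where
    field
      Point    : Set ℓ
      d        : Point → Point → R
      d-nonNeg : ∀ x y → 0# ≤ d x y
      d-refl   : ∀ x → d x x ≡ 0#
      d≡0⇒≡    : ∀ {x y} → d x y ≡ 0# → x ≡ y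
      d-sym    : ∀ x y → d x y ≡ d y x
      triangle : ∀ x y z → d x z ≤ d x y + d y z

  Interval : R → Set ℓ
  Interval r = Σ R λ t → (0# ≤ t) × (t ≤ r)

module _ {ℝ : CompleteOrderedField ℓ} where
  open CompleteOrderedField ℝ renaming (Carrier to R)

  module _ (S : MetricSpace ℝ) where
    open MetricSpace S

    -- d(x,J) is the infimum of the distances from x to points of J.  For
    -- J = ∅ every real is a lower bound, so there is no real infimum; this
    -- is the convention d(x,∅) = +∞.

    IsDistanceTo : Point → Pred Point ℓ → R → Set ℓ
    IsDistanceTo x J = IsInf _≤_ (λ t → ∃ᶜ[ y ] (y ∈ J × d x y ≡ t))

    B : Pred Point ℓ → R → Pred Point ℓ
    B J r x = ∃ᶜ[ t ] (IsDistanceTo x J t × t ≤ r)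

    record IsGeodesic (x y : Point) (ρ : Interval ℝ (d x y) → Point) : Set ℓ where
      field
        isometric : ∀ s t → d (ρ s) (ρ t) ≡ ∣ proj₁ s - proj₁ t ∣
        source    : ρ (0# , ≤-refl , d-nonNeg x y) ≡ x
        target    : ρ (d x y , d-nonNeg x y , ≤-refl) ≡ y

    IsGeodesicSpace : Set ℓ
    IsGeodesicSpace = ∀ x y → ∃ᶜ[ ρ ] IsGeodesic x y ρ

    IsHyperbolic : R → Set ℓ
    IsHyperbolic δ =
      IsGeodesicSpace ×
      (∀ x y z ρxy ρxz ρyz →
         IsGeodesic x y ρxy → IsGeodesic x z ρxz → IsGeodesic y z ρyz →
         image ρxy ⊆ B (image ρxz ∪ image ρyz) δ)

    IsℝTree : Set ℓ
    IsℝTree = IsHyperbolic 0#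

  module _ (S T : MetricSpace ℝ) where
    private
      module S = MetricSpace S
      module T = MetricSpace T

    record IsQuasiIsometryWith (N : ℕ) (f : S.Point → T.Point) : Set ℓ where
      field
        N≥1        : 1 ≤ℕ N
        coarseOnto : ∀ y → y ∈ B T (image f) (fromℕ N)
        lower      : ∀ x y → fromℕ N ⁻¹ * S.d x y - fromℕ N ≤ T.d (f x) (f y)
        upper      : ∀ x y → T.d (f x) (f y) ≤ fromℕ N * S.d x y + fromℕ N

    IsQuasiIsometry : (S.Point → T.Point) → Set ℓ
    IsQuasiIsometry f = ∃ᶜ[ N ] IsQuasiIsometryWith N f

{-# OPTIONS --safe #-}

-- Without choice, a preimage of s ∈ S up to bounded error cannot be picked; it
-- must be defined.  The set A of points a ∈ T with f a close to s is nonempty,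
-- with diameter at most a constant D.  Fix a base point o of T and put
-- r = d(o,A).  In a tree, the geodesics from o to two points a, b of A coincide
-- at least up to depth d(o,a) - d(a,b), hence they all pass through one and the
-- same point at depth max(0, r - D - 1).  That point is h(s).  It lies within
-- 2D + 1 of A, so h is a coarse inverse of f.

module Submission where

open import Defs
open import Axiom.Extensionality.Propositional using (Extensionality; lower-extensionality)
open import Axiom.UniquenessOfIdentityProofs.WithK using (uip)
open import Algebra.Bundles using (CommutativeRing)
import Algebra.Properties.Group as GroupProperties
import Algebra.Properties.Ring as RingProperties
import Algebra.Solver.Ring.NaturalCoefficients.Default as SemiringSolver
open import Data.Empty using (⊥-elim)
open import Data.Nat.Base using (ℕ; zero; suc; s≤s; z≤n)
open import Data.Product.Base using (Σ; _×_; _,_; proj₁; proj₂)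
open import Data.Sum.Base using (_⊎_; inj₁; inj₂; [_,_]′)
open import Function.Base using (const; case_of_)
open import Level using (0ℓ)
open import Relation.Binary.PropositionalEquality
  using (_≡_; _≢_; refl; sym; trans; cong; cong₂; subst; subst₂)
open import Relation.Binary.Structures using (IsTotalOrder)
open import Relation.Nullary using (¬_; Irrelevant)
open import Relation.Nullary.Decidable using (decidable-stable)
open import Relation.Nullary.Negation using (contradiction)
open import Relation.Unary using (Pred; _∈_)

-- The unit of this monad is `contradiction`.
_>>=_ : ∀ {a b} {A : Set a} {B : Set b} → ¬ ¬ A → (A → ¬ ¬ B) → ¬ ¬ B
(m >>= k) ¬b = m λ a → k a ¬b

-- Definite description from excluded middle for propositions

module _ {ℓ} (ext : Extensionality ℓ ℓ) (pem : PropExcludedMiddle ℓ) where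

  ≡-stable : {A : Set ℓ} {x y : A} → ¬ ¬ (x ≡ y) → x ≡ y
  ≡-stable = decidable-stable (pem uip)

  ¬-irrelevant : {P : Set ℓ} → Irrelevant (¬ P)
  ¬-irrelevant p q = lower-extensionality 0ℓ ℓ ext λ x → ⊥-elim (p x)

  -- The pair type with `¬ ¬ P x` is a proposition because `P` has at most one solution, so excluded
  -- middle removes the double negation in front of it. The inner `¬ ¬` matters: `P x` itself may
  -- have many proofs.
  definiteDescription : {A : Set ℓ} (P : A → Set ℓ) →
    (∀ {x y} → P x → P y → x ≡ y) → ∃ᶜ[ x ] P x → Σ A λ x → ¬ ¬ P x
  definiteDescription {A} P unique ∃P =
    decidable-stable (pem irrelevant) λ k → ∃P λ (x , px) → k (x , contradiction px)
    where
    irrelevant : Irrelevant (Σ A λ x → ¬ ¬ P x)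
    irrelevant (x , p) (y , q)
      with refl ← ≡-stable (p >>= λ px → q >>= λ py → contradiction (unique px py))
      = cong (x ,_) (¬-irrelevant p q)

-- Ordered field arithmetic, infima and the Archimedean property

module OrderedField {ℓ} (pem : PropExcludedMiddle ℓ) (ℝ : CompleteOrderedField ℓ) where
  open CompleteOrderedField ℝ renaming (Carrier to R)
  open IsTotalOrder isTotalOrder using (antisym; reflexive) renaming (trans to ≤-trans)

  commutativeRing : CommutativeRing ℓ ℓ
  commutativeRing = record { isCommutativeRing = isCommutativeRing }

  open CommutativeRing commutativeRing
    using (commutativeSemiring; ring; +-group; +-comm; +-identityˡ; +-identityʳ; -‿inverseʳ;
           *-comm; *-assoc; *-identityˡ; zeroʳ)
  open GroupProperties +-group using (//-rightDividesˡ; //-rightDividesʳ; ⁻¹-anti-homo-//; ⁻¹-involutive)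
  open RingProperties ring using (x[y-z]≈xy-xz; -1*x≈-x)
  open SemiringSolver commutativeSemiring using (solve; con; _:+_; _:*_; _:=_)

  ≤-stable : ∀ {x y} → ¬ ¬ (x ≤ y) → x ≤ y
  ≤-stable = decidable-stable (pem ≤-irrelevant)

  x-y+y≡x : ∀ x y → (x - y) + y ≡ x
  x-y+y≡x x y = //-rightDividesˡ y x

  +-cancelʳ-≤ : ∀ z {x y} → x + z ≤ y + z → x ≤ y
  +-cancelʳ-≤ z {x} {y} p = subst₂ _≤_ (//-rightDividesʳ z x) (//-rightDividesʳ z y) (+-monoˡ-≤ (- z) p)

  -- Linear arithmetic: after the hypotheses are added up to a single a ≤ b,
  -- what is left is a semiring identity.
  ≤-by : ∀ {a b x y} → a ≤ b → x + b ≡ y + a → x ≤ y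
  ≤-by {a} {b} {x} {y} a≤b eq = +-cancelʳ-≤ b (≤-trans (reflexive eq)
    (subst₂ _≤_ (+-comm a y) (+-comm b y) (+-monoˡ-≤ y a≤b)))

  infixl 6 _+≤_
  _+≤_ : ∀ {a b c d} → a ≤ b → c ≤ d → a + c ≤ b + d
  _+≤_ {a} {b} {c} {d} p q =
    ≤-trans (+-monoˡ-≤ c p) (subst₂ _≤_ (+-comm c b) (+-comm d b) (+-monoˡ-≤ b q))

  ≤⇒0≤- : ∀ {x y} → x ≤ y → 0# ≤ y - x
  ≤⇒0≤- {x} {y} p = subst (_≤ y - x) (-‿inverseʳ x) (+-monoˡ-≤ (- x) p)

  0≤-⇒≤ : ∀ {x y} → 0# ≤ y - x → x ≤ y
  0≤-⇒≤ {x} {y} p = subst₂ _≤_ (+-identityˡ x) (x-y+y≡x y x) (+-monoˡ-≤ x p)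

  *-monoˡ-≤ : ∀ {z x y} → 0# ≤ z → x ≤ y → z * x ≤ z * y
  *-monoˡ-≤ {z} {x} {y} 0≤z p =
    0≤-⇒≤ (subst (0# ≤_) (x[y-z]≈xy-xz z y x) (*-nonNegative 0≤z (≤⇒0≤- p)))

  *-monoʳ-≤ : ∀ {z x y} → 0# ≤ z → x ≤ y → x * z ≤ y * z
  *-monoʳ-≤ {z} {x} {y} 0≤z p = subst₂ _≤_ (*-comm z x) (*-comm z y) (*-monoˡ-≤ 0≤z p)

  +-nonNegative : ∀ {x y} → 0# ≤ x → 0# ≤ y → 0# ≤ x + y
  +-nonNegative p q = ≤-trans (reflexive (sym (+-identityˡ 0#))) (p +≤ q)

  x≤x+y : ∀ {x y} → 0# ≤ y → x ≤ x + y
  x≤x+y {x} {y} p = subst (_≤ x + y) (+-identityʳ x) (≤-refl +≤ p)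

  x≤y+x : ∀ {x y} → 0# ≤ y → x ≤ y + x
  x≤y+x {x} {y} p = subst (_≤ y + x) (+-identityˡ x) (p +≤ ≤-refl)

  0≤1 : 0# ≤ 1#
  0≤1 = case total 0# 1# of λ where
    (inj₁ p) → p
    (inj₂ p) → let q = subst (0# ≤_) (+-identityˡ (- 1#)) (≤⇒0≤- p) in
      subst (0# ≤_) (trans (-1*x≈-x (- 1#)) (⁻¹-involutive 1#)) (*-nonNegative q q)

  1≰0 : ¬ (1# ≤ 0#)
  1≰0 p = 0≢1 (antisym 0≤1 p)

  x+1≰x : ∀ {x} → ¬ (x + 1# ≤ x)
  x+1≰x {x} p = 1≰0 (≤-by p (solve 1 (λ x → con 1 :+ x := con 0 :+ (x :+ con 1)) refl x))

  fromℕ-nonNegative : ∀ n → 0# ≤ fromℕ n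
  fromℕ-nonNegative zero    = ≤-refl
  fromℕ-nonNegative (suc n) = +-nonNegative 0≤1 (fromℕ-nonNegative n)

  fromℕ-suc≢0 : ∀ n → fromℕ (suc n) ≢ 0#
  fromℕ-suc≢0 n eq = 1≰0 (≤-by (fromℕ-nonNegative n +≤ reflexive eq)
    (solve 1 (λ x → con 1 :+ (x :+ con 0) := con 0 :+ (con 0 :+ (con 1 :+ x))) refl (fromℕ n)))

  inverse-nonNegative : ∀ {x} → 0# ≤ x → x ≢ 0# → 0# ≤ x ⁻¹
  inverse-nonNegative {x} 0≤x x≢0 = case total 0# (x ⁻¹) of λ where
    (inj₁ p) → p
    (inj₂ p) → contradiction
      (subst₂ _≤_ (*-inverseʳ x x≢0) (zeroʳ x) (*-monoˡ-≤ 0≤x p)) 1≰0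

  *-inverse-cancel : ∀ {x} y → x ≢ 0# → x * (x ⁻¹ * y) ≡ y
  *-inverse-cancel {x} y x≢0 =
    trans (sym (*-assoc x (x ⁻¹) y)) (trans (cong (_* y) (*-inverseʳ x x≢0)) (*-identityˡ y))

  inverse-*-cancel : ∀ {x} y → x ≢ 0# → x ⁻¹ * (x * y) ≡ y
  inverse-*-cancel {x} y x≢0 =
    trans (solve 3 (λ x x⁻¹ y → x⁻¹ :* (x :* y) := x :* (x⁻¹ :* y)) refl x (x ⁻¹) y)
          (*-inverse-cancel y x≢0)

  halve : ∀ x → Σ R λ h → h + h ≡ x
  halve x = h , trans (solve 1 (λ h → h :+ h := (con 1 :+ (con 1 :+ con 0)) :* h) refl h)
                      (*-inverse-cancel x (fromℕ-suc≢0 1))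
    where h = fromℕ 2 ⁻¹ * x

  x-y≤0⇒x≤y : ∀ {x y} → x - y ≤ 0# → x ≤ y
  x-y≤0⇒x≤y {x} {y} p = subst₂ _≤_ (x-y+y≡x x y) (+-identityˡ y) (+-monoˡ-≤ y p)

  ∣x-y∣+y≡x : ∀ {x y} → y ≤ x → ∣ x - y ∣ + y ≡ x
  ∣x-y∣+y≡x {x} {y} y≤x with total 0# (x - y)
  ... | inj₁ _ = x-y+y≡x x y
  -- `total` may answer either way when `x - y` is 0; under `y ≤ x` that is all this branch can be.
  ... | inj₂ p with refl ← antisym y≤x (x-y≤0⇒x≤y p) =
    trans (cong (_+ y) (⁻¹-anti-homo-// y y)) (x-y+y≡x y y)

  ∣x-y∣+x≡y : ∀ {x y} → x ≤ y → ∣ x - y ∣ + x ≡ y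
  ∣x-y∣+x≡y {x} {y} x≤y with total 0# (x - y)
  ... | inj₁ p with refl ← antisym x≤y (0≤-⇒≤ p) = x-y+y≡x x x
  ∣x-y∣+x≡y {x} {y} x≤y | inj₂ _ = trans (cong (_+ x) (⁻¹-anti-homo-// x y)) (x-y+y≡x y x)

  ∣x-y∣≤ : ∀ {x y z} → x ≤ y + z → y ≤ x + z → ∣ x - y ∣ ≤ z
  ∣x-y∣≤ {x} {y} {z} p q = case total x y of λ where
    (inj₁ x≤y) → ≤-by (reflexive (∣x-y∣+x≡y x≤y) +≤ q)
      (solve 4 (λ x y z w → w :+ (y :+ (x :+ z)) := z :+ ((w :+ x) :+ y)) refl x y z ∣ x - y ∣)
    (inj₂ y≤x) → ≤-by (reflexive (∣x-y∣+y≡x y≤x) +≤ p)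
      (solve 4 (λ x y z w → w :+ (x :+ (y :+ z)) := z :+ ((w :+ y) :+ x)) refl x y z ∣ x - y ∣)

  infix 8 _⁺
  _⁺ : R → R
  x ⁺ = [ const x , const 0# ]′ (total 0# x)

  ⁺-nonNegative : ∀ x → 0# ≤ x ⁺
  ⁺-nonNegative x with total 0# x
  ... | inj₁ p = p
  ... | inj₂ _ = ≤-refl

  x≤x⁺ : ∀ x → x ≤ x ⁺
  x≤x⁺ x with total 0# x
  ... | inj₁ _ = ≤-refl
  ... | inj₂ p = p

  ⁺-case : ∀ x → (x ⁺ ≡ 0#) ⊎ (x ⁺ ≡ x)
  ⁺-case x with total 0# x
  ... | inj₁ _ = inj₂ refl
  ... | inj₂ _ = inj₁ refl

  -- The infimum is the supremum of the lower bounds, a set that contains `l` and is bounded above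
  -- by every element of `A`.
  inf-exists : (A : Pred R ℓ) → (∃ᶜ[ x ] x ∈ A) → ∀ l → IsLowerBound _≤_ A l →
               ∃ᶜ[ i ] IsInf _≤_ A i
  inf-exists A ∃A l l-lower = do
    s , upper , least ← complete (IsLowerBound _≤_ A) (contradiction (l , l-lower)) do
      x , x∈A ← ∃A
      contradiction (x , λ b b-lower → b-lower x x∈A)
    contradiction (s , (λ x x∈A → least x λ b b-lower → b-lower x x∈A) , upper)

  inf-unique : {A : Pred R ℓ} {i j : R} → IsInf _≤_ A i → IsInf _≤_ A j → i ≡ j
  inf-unique (i-lower , i-greatest) (j-lower , j-greatest) =
    antisym (j-greatest _ i-lower) (i-greatest _ j-lower)

  -- If no natural number reached `x`, then `x` would bound them all. Their supremum `s` could then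
  -- be lowered to `s - 1#`, because the successor of each natural number is still at most `s`.
  archimedean : ∀ x → ∃ᶜ[ n ] x ≤ fromℕ n
  archimedean x ¬∃n = complete naturals
    (contradiction (0# , contradiction (0 , refl)))
    (contradiction (x , x-upper))
    λ (s , upper , least) → x+1≰x (≤-trans
      (+-monoˡ-≤ 1# (least (s - 1#) (s-1-upper upper)))
      (reflexive (x-y+y≡x s 1#)))
    where
    naturals : Pred R ℓ
    naturals t = ∃ᶜ[ n ] fromℕ n ≡ t
    x-upper : IsUpperBound _≤_ naturals x
    x-upper t t∈ = case total t x of λ where
      (inj₁ p) → p
      (inj₂ p) → ⊥-elim (t∈ λ where (n , refl) → ¬∃n (n , p))
    s-1-upper : ∀ {s} → IsUpperBound _≤_ naturals s → IsUpperBound _≤_ naturals (s - 1#)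
    s-1-upper {s} upper t t∈ = ≤-stable do
      n , refl ← t∈
      contradiction
        (≤-by (upper (fromℕ (suc n)) (contradiction (suc n , refl)) +≤ reflexive (sym (x-y+y≡x s 1#)))
          (solve 3 (λ t s s-1 → t :+ (s :+ (s-1 :+ con 1)) := s-1 :+ ((con 1 :+ t) :+ s))
            refl (fromℕ n) s (s - 1#)))

  x+x≤y+y⇒x≤y : ∀ {x y} → x + x ≤ y + y → x ≤ y
  x+x≤y+y⇒x≤y {x} {y} p = case total x y of λ where
    (inj₁ q) → q
    (inj₂ q) → ≤-by (p +≤ q)
      (solve 2 (λ x y → x :+ ((y :+ y) :+ x) := y :+ ((x :+ x) :+ y)) refl x y)

module Geometry {ℓ} (ext : Extensionality ℓ ℓ) (pem : PropExcludedMiddle ℓ)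
                (ℝ : CompleteOrderedField ℓ) where
  open CompleteOrderedField ℝ renaming (Carrier to R)
  open IsTotalOrder isTotalOrder using (antisym; reflexive) renaming (trans to ≤-trans)
  open OrderedField pem ℝ
  open CommutativeRing commutativeRing using (commutativeSemiring; +-identityʳ)
  open SemiringSolver commutativeSemiring using (solve; con; _:+_; _:*_; _:=_)

  -- Neighbourhoods and geodesics

  module _ (X : MetricSpace ℝ) where
    open MetricSpace X

    ∈B⁺ : ∀ {J x c} → (∃ᶜ[ y ] (y ∈ J × d x y ≤ c)) → x ∈ B X J c
    ∈B⁺ {J} {x} ∃y = do
      y , y∈J , p ← ∃y
      t , t-inf ← inf-exists _ (contradiction (d x y , contradiction (y , y∈J , refl))) 0#
        λ u u∈ → ≤-stable do
          z , _ , refl ← u∈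
          contradiction (d-nonNeg x z)
      contradiction (t , t-inf , ≤-trans (proj₁ t-inf _ (contradiction (y , y∈J , refl))) p)

    -- The infimum need not be attained, hence the slack 1: if all points of `J` were farther than
    -- `c + 1#` from `x`, that number would be a lower bound, yet the infimum is at most `c`.
    ∈B⁻ : ∀ {J x c} → x ∈ B X J c → ∃ᶜ[ y ] (y ∈ J × d x y ≤ c + 1#)
    ∈B⁻ {J} {x} {c} x∈B ¬∃y = x∈B λ (t , (_ , greatest) , t≤c) →
      x+1≰x (≤-trans (greatest (c + 1#) λ u u∈ → ≤-stable (do
        y , y∈J , refl ← u∈
        case total (d x y) (c + 1#) of λ where
          (inj₁ p) → ⊥-elim (¬∃y (y , y∈J , p))
          (inj₂ p) → contradiction p)) t≤c)

    Interval-≡ : ∀ {r} {σ τ : Interval ℝ r} → proj₁ σ ≡ proj₁ τ → σ ≡ τ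
    Interval-≡ {σ = t , _} refl = cong₂ (λ p q → t , p , q) (≤-irrelevant _ _) (≤-irrelevant _ _)

    module _ {x y ρ} (g : IsGeodesic X x y ρ) where
      open IsGeodesic g

      d-source : ∀ τ → d x (ρ τ) ≡ proj₁ τ
      d-source τ@(_ , 0≤τ , _) =
        trans (cong (λ z → d z (ρ τ)) (sym source))
          (trans (isometric _ τ) (trans (sym (+-identityʳ _)) (∣x-y∣+x≡y 0≤τ)))

      d-target : ∀ τ → d (ρ τ) y + proj₁ τ ≡ d x y
      d-target τ@(t , _ , τ≤) =
        trans (cong (λ z → d (ρ τ) z + t) (sym target))
          (trans (cong (_+ t) (isometric τ _)) (∣x-y∣+x≡y τ≤))

      at-zero : ∀ τ → proj₁ τ ≡ 0# → ρ τ ≡ x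
      at-zero τ eq = trans (cong ρ (Interval-≡ eq)) source

    -- A point q of [a,b] is at distance at least 1 from p = ρ σ, because of the
    -- spare 1 in the last hypothesis, whereas for q in [o,b] the distance from p
    -- to q is at least half of d p p′.  Both would bound the distance from p to
    -- [o,b] ∪ [a,b], which is 0, from below, so d p p′ = 0.
    geodesics-agree : IsℝTree X → ∀ {o a b ρ ρ′} → IsGeodesic X o a ρ → IsGeodesic X o b ρ′ →
      ∀ σ τ → proj₁ σ ≡ proj₁ τ → proj₁ σ + 1# + d a b ≤ d o a → ρ σ ≡ ρ′ τ
    geodesics-agree (geodesic , thin) {o} {a} {b} {ρ} {ρ′} g g′ σ@(s , _) τ s≡t room = ≡-stable ext pem do
      ρ″ , g″ ← geodesic a b
      i , (_ , greatest) , i≤0 ← thin o a b ρ ρ′ ρ″ g g′ g″ (contradiction (σ , refl))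
      let
        far : ∀ c → c + c ≤ d p p′ → c ≤ 1# → c ≤ 0#
        far c c+c≤δ c≤1 = ≤-trans (greatest c λ u u∈ → ≤-stable (do
          q , q∈ , refl ← u∈
          case q∈ of λ where
            (inj₁ q∈′) → do
              υ , refl ← q∈′
              contradiction (near-other-side c c+c≤δ υ)
            (inj₂ q∈″) → do
              υ , refl ← q∈″
              contradiction (≤-trans c≤1 (far-from-base g″ υ)))) i≤0
        c , c+c≡δ = halve (d p p′)
      contradiction (d≡0⇒≡ (antisym (δ≤0 far c c+c≡δ) (d-nonNeg p p′)))
      where
      p p′ : Point
      p  = ρ σ
      p′ = ρ′ τ

      -- `p′` and `ρ′ υ` lie on one geodesic from `o`, so their distance is the difference of their
      -- distances to `o`. Since `p` is as far from `o` as `p′`, this is at most `d p (ρ′ υ)`, and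
      -- the path through `ρ′ υ` bounds `d p p′` by twice that.
      near-other-side : ∀ c → c + c ≤ d p p′ → ∀ υ → c ≤ d p (ρ′ υ)
      near-other-side c c+c≤δ υ = x+x≤y+y⇒x≤y (≤-trans c+c≤δ (≤-trans (triangle p (ρ′ υ) p′)
        (≤-refl +≤ subst (_≤ e) (sym (IsGeodesic.isometric g′ υ τ)) (∣x-y∣≤ u≤t+e t≤u+e))))
        where
        e : R
        e = d p (ρ′ υ)
        u≤t+e : proj₁ υ ≤ proj₁ τ + e
        u≤t+e = subst₂ (λ u t → u ≤ t + e) (d-source g′ υ) (trans (d-source g σ) s≡t)
                  (triangle o p (ρ′ υ))
        t≤u+e : proj₁ τ ≤ proj₁ υ + e
        t≤u+e = subst₂ _≤_ (trans (d-source g σ) s≡t)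
                  (cong₂ _+_ (d-source g′ υ) (d-sym (ρ′ υ) p)) (triangle o (ρ′ υ) p)

      -- The point `ρ″ υ` is at least `d o a - d a b` away from `o`, hence by `room` at least
      -- `s + 1#`, whereas `p` is only `s` away.
      far-from-base : ∀ {ρ″} → IsGeodesic X a b ρ″ → ∀ υ → 1# ≤ d p (ρ″ υ)
      far-from-base {ρ″} g″ υ@(u , _ , u≤) = ≤-by
        (room +≤ u≤ +≤ triangle o (ρ″ υ) a +≤ triangle o p (ρ″ υ)
          +≤ reflexive (d-source g σ) +≤ reflexive (trans (d-sym (ρ″ υ) a) (d-source g″ υ)))
        (solve 8 (λ s ab oa u oq qa op pq →
            con 1 :+ (oa :+ ab :+ (oq :+ qa) :+ (op :+ pq) :+ s :+ u)
            := pq :+ (s :+ con 1 :+ ab :+ u :+ oa :+ oq :+ op :+ qa))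
          refl s (d a b) (d o a) u (d o (ρ″ υ)) (d (ρ″ υ) a) (d o p) (d p (ρ″ υ)))

      -- `far` is available only up to 1. If half of `d p p′` is at least 1, `far` at 1 gives the
      -- absurd `1# ≤ 0#`; otherwise it applies to the half itself.
      δ≤0 : (∀ c → c + c ≤ d p p′ → c ≤ 1# → c ≤ 0#) → ∀ c → c + c ≡ d p p′ → d p p′ ≤ 0#
      δ≤0 far c c+c≡δ = case total c 1# of λ where
        (inj₁ c≤1) → let c≤0 = far c (reflexive c+c≡δ) c≤1 in
          subst₂ _≤_ c+c≡δ (+-identityʳ 0#) (c≤0 +≤ c≤0)
        (inj₂ 1≤c) → contradiction (far 1# (≤-trans (1≤c +≤ 1≤c) (reflexive c+c≡δ)) ≤-refl) 1≰0

    -- The common point of the geodesics to a bounded set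

    module Meet (tree : IsℝTree X) (o : Point) (D : R) (A : Pred Point ℓ) where

      -- Quantifying over every point of `A` and every geodesic keeps this free of choices. In the
      -- depth, `D` pays for the distance between two points of `A` and `1#` is the spare 1 of
      -- `geodesics-agree`; the positive part handles sets too close to `o`.
      IsMeet : Point → Set ℓ
      IsMeet m = Σ R λ r → IsDistanceTo X o A r ×
        (∀ {a ρ} → a ∈ A → IsGeodesic X o a ρ → ∀ τ → proj₁ τ ≡ (r - (1# + D)) ⁺ → ρ τ ≡ m)

      distance-≤ : ∀ {r a} → IsDistanceTo X o A r → a ∈ A → r ≤ d o a
      distance-≤ (lower , _) a∈A = lower _ (contradiction (_ , a∈A , refl))

      depth : ∀ {r a} → IsDistanceTo X o A r → 0# ≤ D → a ∈ A → Interval ℝ (d o a)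
      depth {r} {a} r-dist 0≤D a∈A = t , ⁺-nonNegative _ , t≤
        where
        t : R
        t = (r - (1# + D)) ⁺
        t≤ : t ≤ d o a
        t≤ = case ⁺-case (r - (1# + D)) of λ where
          (inj₁ eq) → subst (_≤ d o a) (sym eq) (d-nonNeg o a)
          (inj₂ eq) → subst (_≤ d o a) (sym eq) (≤-by
            (distance-≤ r-dist a∈A +≤ 0≤1 +≤ 0≤D +≤ reflexive (x-y+y≡x r (1# + D)))
            (solve 4 (λ z r oa D → z :+ (oa :+ con 1 :+ D :+ r)
                := oa :+ (r :+ con 0 :+ con 0 :+ (z :+ (con 1 :+ D))))
              refl (r - (1# + D)) r (d o a) D))

      -- Both candidates lie on one geodesic to one point of `A`, at the same depth because the
      -- infimum is unique.
      IsMeet-unique : (∃ᶜ[ a ] a ∈ A) → 0# ≤ D → ∀ {m n} → IsMeet m → IsMeet n → m ≡ n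
      IsMeet-unique ∃A 0≤D (r , r-dist , m-at) (s , s-dist , n-at) = ≡-stable ext pem do
        a , a∈A ← ∃A
        ρ , g ← proj₁ tree o a
        let τ = depth r-dist 0≤D a∈A
        contradiction (trans (sym (m-at a∈A g τ refl))
          (n-at a∈A g τ (cong (λ r → (r - (1# + D)) ⁺) (inf-unique r-dist s-dist))))

      module _ (0≤D : 0# ≤ D) (diameter : ∀ {a b} → a ∈ A → b ∈ A → d a b ≤ D) where

        IsMeet-exists : (∃ᶜ[ a ] a ∈ A) → ∃ᶜ[ m ] IsMeet m
        IsMeet-exists ∃A = do
          a , a∈A ← ∃A
          ρ , g ← proj₁ tree o a
          r , r-dist ← inf-exists _ (contradiction (d o a , contradiction (a , a∈A , refl))) 0#
            λ u u∈ → ≤-stable do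
              z , _ , refl ← u∈
              contradiction (d-nonNeg o z)
          let τ = depth r-dist 0≤D a∈A
          contradiction (ρ τ , r , r-dist , λ {b} {ρ′} b∈A g′ υ υ≡ → case ⁺-case (r - (1# + D)) of λ where
            (inj₁ eq) → trans (at-zero g′ υ (trans υ≡ eq)) (sym (at-zero g τ eq))
            -- The depth plus `1# + d b a` is at most `r`, which is at most `d o b`.
            (inj₂ eq) → geodesics-agree tree g′ g υ τ υ≡ (≤-by
              (distance-≤ r-dist b∈A +≤ diameter b∈A a∈A
                +≤ reflexive (trans υ≡ eq) +≤ reflexive (x-y+y≡x r (1# + D)))
              (solve 6 (λ u z r ob ba D → u :+ con 1 :+ ba :+ (ob :+ D :+ z :+ r)
                  := ob :+ (r :+ ba :+ u :+ (z :+ (con 1 :+ D))))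
                refl (proj₁ υ) (r - (1# + D)) r (d o b) (d b a) D)))

        -- On a geodesic to `a`, the point at depth `t` is `d o a - t` away from `a`. Here `t` is at
        -- least `r - (1# + D)`, and `d o a` is at most `r + D` because all points of `A` are within
        -- `D` of `a`.
        IsMeet-near : ∀ {m a} → IsMeet m → a ∈ A → d m a ≤ 1# + D + D
        IsMeet-near {m} {a} (r , r-dist , m-at) a∈A = ≤-stable do
          ρ , g ← proj₁ tree o a
          let
            τ = depth r-dist 0≤D a∈A
            t = proj₁ τ
            ma+t≡oa : d m a + t ≡ d o a
            ma+t≡oa = subst (λ z → d z a + t ≡ d o a) (m-at a∈A g τ refl) (d-target g τ)
          contradiction (≤-by
            (reflexive ma+t≡oa +≤ oa-D≤r +≤ reflexive (sym (x-y+y≡x (d o a) D))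
              +≤ reflexive (sym (x-y+y≡x r (1# + D))) +≤ x≤x⁺ (r - (1# + D)))
            (solve 7 (λ ma t oa w r z D → ma :+ (oa :+ r :+ (w :+ D) :+ (z :+ (con 1 :+ D)) :+ t)
                := con 1 :+ D :+ D :+ (ma :+ t :+ w :+ oa :+ r :+ z))
              refl (d m a) t (d o a) (d o a - D) r (r - (1# + D)) D))
          where
          oa-D≤r : d o a - D ≤ r
          oa-D≤r = proj₂ r-dist (d o a - D) λ u u∈ → ≤-stable do
            b , b∈A , refl ← u∈
            contradiction (≤-by
              (triangle o b a +≤ diameter b∈A a∈A +≤ reflexive (x-y+y≡x (d o a) D))
              (solve 5 (λ w oa ob ba D → w :+ (ob :+ ba :+ D :+ oa) := ob :+ (oa :+ ba :+ (w :+ D)))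
                refl (d o a - D) (d o a) (d o b) (d b a) D))

  -- Affine distance bounds and quasi-isometries

  module _ (X Y : MetricSpace ℝ) where
    private
      module X = MetricSpace X
      module Y = MetricSpace Y

    -- Bounds with a real constant compose more easily; the Archimedean property rounds the constant
    -- up to a natural number.
    affine⇒quasiIsometry : ∀ {h c} → 0# ≤ c →
      (∀ y → ∃ᶜ[ x ] Y.d (h x) y ≤ c) →
      (∀ x x′ → Y.d (h x) (h x′) ≤ c * X.d x x′ + c) →
      (∀ x x′ → X.d x x′ ≤ c * Y.d (h x) (h x′) + c) →
      IsQuasiIsometry X Y h
    affine⇒quasiIsometry {h} {c} 0≤c onto above below = do
      L , c≤l ← archimedean c
      let
        l = fromℕ L
        -- The successor makes `K` nonzero, so that `K ⁻¹` is a true inverse.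
        K = fromℕ (suc L)
        c≤K : c ≤ K
        c≤K = ≤-trans c≤l (x≤y+x 0≤1)
        0≤K = fromℕ-nonNegative (suc L)
        0≤K⁻¹ = inverse-nonNegative 0≤K (fromℕ-suc≢0 L)
      contradiction (suc L , record
        { N≥1 = s≤s z≤n
        ; coarseOnto = λ y → ∈B⁺ Y do
            x , p ← onto y
            contradiction (h x , contradiction (x , refl) ,
              subst (_≤ K) (Y.d-sym (h x) y) (≤-trans p c≤K))
        ; lower = λ x x′ →
            let
              e = Y.d (h x) (h x′)
              0≤e = Y.d-nonNeg (h x) (h x′)
              0≤l = fromℕ-nonNegative L
              -- The required lower bound, multiplied by `K`; the term `K * K` absorbs `c`.
              d≤K[e+K] : X.d x x′ ≤ K * (e + K)
              d≤K[e+K] = ≤-by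
                (below x x′ +≤ *-monoʳ-≤ 0≤e c≤K +≤ c≤l +≤ *-nonNegative 0≤l 0≤l +≤ 0≤l +≤ 0≤1)
                (solve 4 (λ d e c l → d :+ (c :* e :+ c :+ (con 1 :+ l) :* e :+ l :+ l :* l :+ l :+ con 1)
                    := (con 1 :+ l) :* (e :+ (con 1 :+ l)) :+ (d :+ c :* e :+ c :+ con 0 :+ con 0 :+ con 0))
                  refl (X.d x x′) e c l)
            in ≤-by
              (subst (K ⁻¹ * X.d x x′ ≤_) (inverse-*-cancel (e + K) (fromℕ-suc≢0 L))
                 (*-monoˡ-≤ 0≤K⁻¹ d≤K[e+K])
               +≤ reflexive (x-y+y≡x (K ⁻¹ * X.d x x′) K))
              (solve 4 (λ w z e k → w :+ (e :+ k :+ z) := e :+ (z :+ (w :+ k)))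
                refl (K ⁻¹ * X.d x x′ - K) (K ⁻¹ * X.d x x′) e K)
        ; upper = λ x x′ → ≤-trans (above x x′) (*-monoʳ-≤ (X.d-nonNeg x x′) c≤K +≤ c≤K)
        })

    quasiIsometry-expands : ∀ {N f} → IsQuasiIsometryWith X Y N f →
      ∀ x x′ → X.d x x′ ≤ fromℕ N * (Y.d (f x) (f x′) + fromℕ N)
    quasiIsometry-expands {suc N} {f} qi x x′ =
      subst (_≤ n * (e + n)) (*-inverse-cancel (X.d x x′) (fromℕ-suc≢0 N))
        (*-monoˡ-≤ (fromℕ-nonNegative (suc N)) (≤-by
          (IsQuasiIsometryWith.lower qi x x′ +≤ reflexive (sym (x-y+y≡x z n)))
          (solve 4 (λ z e n w → z :+ (e :+ (w :+ n)) := e :+ n :+ (w :+ z)) refl z e n (z - n))))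
      where
      n e z : R
      n = fromℕ (suc N)
      e = Y.d (f x) (f x′)
      z = n ⁻¹ * X.d x x′
    quasiIsometry-expands {zero} qi = case IsQuasiIsometryWith.N≥1 qi of λ ()

  -- The coarse inverse and its distance bounds

  module CoarseInverse (T S : MetricSpace ℝ) (tree : IsℝTree T) (o : MetricSpace.Point T)
           {f : MetricSpace.Point T → MetricSpace.Point S} {N : ℕ}
           (qi : IsQuasiIsometryWith T S N f) where
    private
      module T = MetricSpace T
      module S = MetricSpace S

    -- `E` is the radius `n` with the slack 1 of `∈B⁻`, so that fibres are inhabited. Two points of
    -- one fibre have images at most `E + E` apart, which `quasiIsometry-expands` turns into `D`;
    -- `C` is the bound of `IsMeet-near`.
    n E D C : R
    n = fromℕ N
    E = n + 1#
    D = n * (E + E + n)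
    C = 1# + D + D

    0≤n : 0# ≤ n
    0≤n = fromℕ-nonNegative N
    0≤E : 0# ≤ E
    0≤E = +-nonNegative 0≤n 0≤1
    0≤D : 0# ≤ D
    0≤D = *-nonNegative 0≤n (+-nonNegative (+-nonNegative 0≤E 0≤E) 0≤n)
    0≤C : 0# ≤ C
    0≤C = +-nonNegative (+-nonNegative 0≤1 0≤D) 0≤D

    Fibre : S.Point → Pred T.Point ℓ
    Fibre s a = S.d s (f a) ≤ E

    Fibre-inhabited : ∀ s → ∃ᶜ[ a ] a ∈ Fibre s
    Fibre-inhabited s = do
      y , y∈ , p ← ∈B⁻ S (IsQuasiIsometryWith.coarseOnto qi s)
      a , refl ← y∈
      contradiction (a , p)

    -- The path from `f a` to `f b` through `s` and `s′` is expanded back to `T`. With `s` equal to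
    -- `s′` this bounds the diameter of a fibre; in general it serves the upper bound for `h`.
    Fibre-distance : ∀ {s s′ a b} → a ∈ Fibre s → b ∈ Fibre s′ → T.d a b ≤ n * S.d s s′ + D
    Fibre-distance {s} {s′} {a} {b} a∈ b∈ = ≤-trans (quasiIsometry-expands T S qi a b)
      (≤-trans
        (*-monoˡ-≤ 0≤n (≤-by
          (S.triangle (f a) s (f b) +≤ S.triangle s s′ (f b) +≤ a∈ +≤ b∈ +≤ reflexive (S.d-sym (f a) s))
          (solve 8 (λ ab as sa sb s′b ss′ e n →
              ab :+ n :+ (as :+ sb :+ (ss′ :+ s′b) :+ e :+ e :+ sa)
              := ss′ :+ (e :+ e :+ n) :+ (ab :+ sb :+ sa :+ s′b :+ as))
            refl (S.d (f a) (f b)) (S.d (f a) s) (S.d s (f a)) (S.d s (f b)) (S.d s′ (f b)) (S.d s s′) E n)))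
        (reflexive (solve 3 (λ n x y → n :* (x :+ y) := n :* x :+ n :* y)
          refl n (S.d s s′) (E + E + n))))

    Fibre-diameter : ∀ {s a b} → a ∈ Fibre s → b ∈ Fibre s → T.d a b ≤ D
    Fibre-diameter {s} {a} {b} a∈ b∈ =
      subst (T.d a b ≤_) (trans (cong (λ z → n * z + D) (S.d-refl s))
          (solve 2 (λ n D → n :* con 0 :+ D := D) refl n D))
        (Fibre-distance a∈ b∈)

    open module FibreMeet (s : S.Point) = Meet T tree o D (Fibre s)

    -- Existence and uniqueness make the point definable, so no element of a fibre is ever selected.
    inverse : ∀ s → Σ T.Point λ m → ¬ ¬ IsMeet s m
    inverse s = definiteDescription ext pem (IsMeet s)
      (IsMeet-unique s (Fibre-inhabited s) 0≤D)
      (IsMeet-exists s 0≤D Fibre-diameter (Fibre-inhabited s))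

    h : S.Point → T.Point
    h s = proj₁ (inverse s)

    h-near : ∀ {s a} → a ∈ Fibre s → T.d (h s) a ≤ C
    h-near {s} a∈ = ≤-stable do
      m-meet ← proj₂ (inverse s)
      contradiction (IsMeet-near s 0≤D Fibre-diameter m-meet a∈)

    h-onto : ∀ x → ∃ᶜ[ s ] T.d (h s) x ≤ C
    h-onto x = contradiction (f x , h-near (subst (_≤ E) (sym (S.d-refl (f x))) 0≤E))

    above below : R
    above = D + C + C
    below = E + E + n + n * (C + C)

    0≤above : 0# ≤ above
    0≤above = +-nonNegative (+-nonNegative 0≤D 0≤C) 0≤C
    0≤below : 0# ≤ below
    0≤below = +-nonNegative (+-nonNegative (+-nonNegative 0≤E 0≤E) 0≤n)
                (*-nonNegative 0≤n (+-nonNegative 0≤C 0≤C))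

    -- The path `h s`, `a`, `b`, `h s′` costs `C` at each end and a fibre distance in the middle.
    h-above : ∀ s s′ → T.d (h s) (h s′) ≤ n * S.d s s′ + above
    h-above s s′ = ≤-stable do
      a , a∈ ← Fibre-inhabited s
      b , b∈ ← Fibre-inhabited s′
      contradiction (≤-by
        (T.triangle (h s) a (h s′) +≤ T.triangle a b (h s′) +≤ h-near a∈ +≤ h-near b∈
          +≤ reflexive (T.d-sym b (h s′)) +≤ Fibre-distance a∈ b∈)
        (solve 9 (λ hh ha ah ab bh hb n*d D C →
            hh :+ (ha :+ ah :+ (ab :+ bh) :+ C :+ C :+ hb :+ (n*d :+ D))
            := n*d :+ (D :+ C :+ C) :+ (hh :+ ah :+ ha :+ hb :+ bh :+ ab))
          refl (T.d (h s) (h s′)) (T.d (h s) a) (T.d a (h s′)) (T.d a b) (T.d b (h s′))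
            (T.d (h s′) b) (n * S.d s s′) D C))

    -- The path `s`, `f a`, `f b`, `s′` costs `E` at each end; its middle is controlled by `d a b`,
    -- which exceeds the distance from `h s` to `h s′` by at most `C + C`.
    h-below : ∀ s s′ → S.d s s′ ≤ n * T.d (h s) (h s′) + below
    h-below s s′ = ≤-stable do
      a , a∈ ← Fibre-inhabited s
      b , b∈ ← Fibre-inhabited s′
      let
        ab≤ : T.d a b ≤ T.d (h s) (h s′) + (C + C)
        ab≤ = ≤-by
          (T.triangle a (h s) b +≤ T.triangle (h s) (h s′) b +≤ h-near a∈ +≤ h-near b∈
            +≤ reflexive (T.d-sym a (h s)))
          (solve 7 (λ ab ah ha hb h′b hh C →
              ab :+ (ah :+ hb :+ (hh :+ h′b) :+ C :+ C :+ ha)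
              := hh :+ (C :+ C) :+ (ab :+ hb :+ ha :+ h′b :+ ah))
            refl (T.d a b) (T.d a (h s)) (T.d (h s) a) (T.d (h s) b) (T.d (h s′) b) (T.d (h s) (h s′)) C)
      contradiction (≤-by
        (S.triangle s (f a) s′ +≤ S.triangle (f a) (f b) s′ +≤ a∈ +≤ b∈
          +≤ reflexive (S.d-sym (f b) s′) +≤ IsQuasiIsometryWith.upper qi a b +≤ *-monoˡ-≤ 0≤n ab≤)
        (solve 11 (λ ss sa as ab bs sb n*ab n hh C e →
            ss :+ (sa :+ as :+ (ab :+ bs) :+ e :+ e :+ sb :+ (n*ab :+ n) :+ n :* (hh :+ C))
            := n :* hh :+ (e :+ e :+ n :+ n :* C) :+ (ss :+ as :+ sa :+ sb :+ bs :+ ab :+ n*ab))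
          refl (S.d s s′) (S.d s (f a)) (S.d (f a) s′) (S.d (f a) (f b)) (S.d (f b) s′)
            (S.d s′ (f b)) (n * T.d a b) n (T.d (h s) (h s′)) (C + C) E))

    h-quasiIsometry : IsQuasiIsometry S T h
    h-quasiIsometry = affine⇒quasiIsometry S T
      (+-nonNegative (+-nonNegative 0≤n 0≤above) 0≤below)
      (λ x → do
        s , p ← h-onto x
        contradiction (s , ≤-trans p C≤bound))
      (λ s s′ → ≤-trans (h-above s s′) (*-monoʳ-≤ (S.d-nonNeg s s′) n≤bound +≤ above≤bound))
      (λ s s′ → ≤-trans (h-below s s′) (*-monoʳ-≤ (T.d-nonNeg (h s) (h s′)) n≤bound +≤ below≤bound))
      where
      bound : R
      bound = n + above + below
      n≤bound : n ≤ bound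
      n≤bound = ≤-trans (x≤x+y 0≤above) (x≤x+y 0≤below)
      above≤bound : above ≤ bound
      above≤bound = ≤-trans (x≤y+x 0≤n) (x≤x+y 0≤below)
      below≤bound : below ≤ bound
      below≤bound = x≤y+x (+-nonNegative 0≤n 0≤above)
      C≤bound : C ≤ bound
      C≤bound = ≤-trans (x≤y+x (+-nonNegative 0≤D 0≤C)) above≤bound

-- Assembly: trees with and without a base point

mainTheorem4 : ∀ {ℓ} → Extensionality ℓ ℓ → PropExcludedMiddle ℓ →
    (ℝ : CompleteOrderedField ℓ) (T S : MetricSpace ℝ) →
    IsℝTree T →
    (f : MetricSpace.Point T → MetricSpace.Point S) →
    IsQuasiIsometry T S f →
    ∃ᶜ[ h ] IsQuasiIsometry S T h
mainTheorem4 {ℓ} ext pem ℝ T S tree f f-qi = do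
  N , qi ← f-qi
  -- Under the refutation `¬∃h`, a base point would yield an inverse, so `T` is empty; the empty
  -- case then yields one as well.
  λ ¬∃h → ¬∃h (empty-case (λ o → ¬∃h (coarse-inverse o qi)) qi)
  where
  open CompleteOrderedField ℝ
  open Geometry ext pem ℝ
  module T = MetricSpace T
  module S = MetricSpace S

  coarse-inverse : ∀ {N} → T.Point → IsQuasiIsometryWith T S N f →
                   Σ (S.Point → T.Point) (IsQuasiIsometry S T)
  coarse-inverse o qi = h , h-quasiIsometry
    where open CoarseInverse T S tree o qi

  -- Every point of `S` is near the image of `f`, so `S` is empty along with `T` and the empty
  -- function works.
  empty-case : ∀ {N} → ¬ T.Point → IsQuasiIsometryWith T S N f →
               Σ (S.Point → T.Point) (IsQuasiIsometry S T)
  empty-case ¬T qi = (λ s → ⊥-elim (¬S s)) , affine⇒quasiIsometry S T ≤-refl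
    (λ x → ⊥-elim (¬T x)) (λ s → ⊥-elim (¬S s)) (λ s → ⊥-elim (¬S s))
    where
    ¬S : ¬ S.Point
    ¬S s = ∈B⁻ S (IsQuasiIsometryWith.coarseOnto qi s) λ (_ , y∈ , _) → y∈ λ (a , _) → ¬T a
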